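{- For every real $0<\epsilon<1$ and all integers $n,k$ with $\frac{2}{\epsilon}\le n$ and $2\le k\le \epsilon n$, there exists a feasible heterogeneous irredundant PV graph $\vec G_R$ with $n$ sites and $k$ carriers such that $$\mathcal M(\vec G_R)>\tfrac14(1-\epsilon)^2\,n^2\,(k-2).$$ This holds even if the agent knows $\vec G_R$, $n$ and $k$ and has unlimited memory.
   Context: A PV system consists of a finite set $S$ of $n$ sites and a set $C$ of $k\le n$ carriers; each carrier $c$ has a unique identifier and a route $\pi(c)=\langle x_0,\dots,x_{p(c)-1}\rangle$ of sites, with period $p(c)$ and $\pi(c)[j]=x_{j\bmod p(c)}$; at each time $t=0,1,\dots$ carrier $c$ moves from $\pi(c)[t]$ to $\pi(c)[t+1]$. The PV graph $\vec G_R$ is the directed edge-labelled multigraph on $S$ with edges $\bigcup_c\{(x_i,x_{i+1},i)\}$ (indices mod $p(c)$). It is homogeneous if all periods are equal, heterogeneous otherwise. A route is simple if $x_i\ne x_{i+1}$ for all $i$ and $(x_i,x_{i+1})=(x_j,x_{j+1})$ implies $i=j$. A route is irredundant (circular) if it is simple and its directed graph $\{(x_i,x_{i+1})\}$ is either a simple cycle or the closed walk of a simple traversal of a tree (each tree edge traversed once in each direction). The PV graph is irredundant if every route is irredundant. An exploring agent is placed at time $0$ at a starting site $x\in\{\pi(c)[0]:c\in C\}$; at each time $t$, being at site $y$, it either halts or chooses a carrier $c$ with $\pi(c)[t]=y$ and moves with it to $\pi(c)[t+1]$ (one move). $\vec G_R$ is feasible if from every starting site there is a finite sequence of such moves visiting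 all sites. $\mathcal M(\vec G_R)$ is the minimum, over all agent strategies (which may use complete knowledge of $\vec G_R$ and unlimited memory) that from every starting site visit all sites and halt, of the maximum over starting sites of the number of moves made. -}

module Defs where

open import Data.Nat using (ℕ; zero; suc; NonZero)
open import Data.Nat.DivMod using (_mod_)
open import Data.Fin using (Fin; toℕ)
open import Data.List using (List; []; _∷_; length)
open import Data.List.Membership.Propositional using (_∈_)
open import Data.Product using (Σ; ∃; _×_; _,_)
open import Data.Sum using (_⊎_)
open import Data.Empty using (⊥)
open import Relation.Nullary using (¬_)
open import Relation.Binary.PropositionalEquality using (_≡_; _≢_)
open import Function.Definitions using (Injective)

-- A PV system with sites Fin n and carriers Fin k (carrier identifiers).
-- Carrier c has period p(c) ≥ 1 and route ⟨x_0,…,x_{p(c)-1}⟩ = route c.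
record PV (n k : ℕ) : Set where
  field
    period    : Fin k → ℕ
    period-nz : (c : Fin k) → NonZero (period c)
    route     : (c : Fin k) → Fin (period c) → Fin n

  pos : Fin k → ℕ → Fin n
  pos c t = route c ((t mod period c) {{period-nz c}})

open PV public

Heterogeneous : ∀ {n k} → PV n k → Set
Heterogeneous G = Σ (Fin _) λ c → Σ (Fin _) λ d → period G c ≢ period G d

module _ {n k : ℕ} (G : PV n k) (c : Fin k) where
  private
    x : ℕ → Fin n
    x = pos G c
    P = Fin (period G c)

  SimpleRoute : Set
  SimpleRoute =
    ((i : P) → x (toℕ i) ≢ x (suc (toℕ i))) ×
    ((i j : P) → x (toℕ i) ≡ x (toℕ j) → x (suc (toℕ i)) ≡ x (suc (toℕ j)) → i ≡ j)

  RouteEdge : Fin n → Fin n → Set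
  RouteEdge u v = Σ P λ i → (x (toℕ i) ≡ u) × (x (suc (toℕ i)) ≡ v)

  IsSimpleCycle : Set
  IsSimpleCycle = Injective _≡_ _≡_ (route G c)

  Acyclic : Set
  Acyclic = (m : ℕ) (v : Fin (suc (suc (suc m))) → Fin n) →
            Injective _≡_ _≡_ v →
            ((j : Fin (suc (suc (suc m)))) →
               let a = v j
                   b = v ((suc (toℕ j)) mod (suc (suc (suc m))))
               in RouteEdge a b ⊎ RouteEdge b a) → ⊥

  -- closed walk of a simple traversal of a tree: every tree edge is traversed
  -- exactly once in each direction (once: by simplicity; reverse: below),
  -- and the underlying undirected graph (connected, being a closed walk) is acyclic
  IsTreeTraversal : Set
  IsTreeTraversal =
    ((i : P) → RouteEdge (x (suc (toℕ i))) (x (toℕ i))) × Acyclic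

  IrredundantRoute : Set
  IrredundantRoute = SimpleRoute × (IsSimpleCycle ⊎ IsTreeTraversal)

Irredundant : ∀ {n k} → PV n k → Set
Irredundant G = ∀ c → IrredundantRoute G c

IsStart : ∀ {n k} → PV n k → Fin n → Set
IsStart G y = Σ (Fin _) λ c → pos G c 0 ≡ y

data Walk {n k : ℕ} (G : PV n k) : ℕ → Fin n → Set where
  halt : ∀ {t y} → Walk G t y
  move : ∀ {t y} (c : Fin k) → pos G c t ≡ y → Walk G (suc t) (pos G c (suc t)) → Walk G t y

visited : ∀ {n k} {G : PV n k} {t y} → Walk G t y → List (Fin n)
visited {y = y} halt = y ∷ []
visited {y = y} (move _ _ w) = y ∷ visited w

moves : ∀ {n k} {G : PV n k} {t y} → Walk G t y → ℕ
moves halt = 0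
moves (move _ _ w) = suc (moves w)

CoveringWalk : ∀ {n k} → PV n k → Fin n → Set
CoveringWalk G y = Σ (Walk G 0 y) λ w → (s : Fin _) → s ∈ visited w

-- an exploration strategy (complete knowledge, unlimited memory): for every
-- starting site, a run visiting all sites and halting
Strategy : ∀ {n k} → PV n k → Set
Strategy G = (y : Fin _) → IsStart G y → CoveringWalk G y

Feasible : ∀ {n k} → PV n k → Set
Feasible G = Strategy G

{-# OPTIONS --safe #-}

-- A hub carrier cycles with period q, and k − 1 leaf carriers cycle with period
-- p = q + 1 at pairwise different phases; the routes of the leaves pass through one
-- common hub site, one site of their own each, and a shared pool of p − 2 sites.  Leaves
-- never meet each other, and each meets the hub exactly once every p q time units.  So an
-- agent that starts on the hub and visits a leaf's own site must wait p q before it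
-- can be back on the hub: visiting the first k − 2 leaves takes (k − 2) p q moves.
-- With m = n − k, all sites are used with 2 q ≈ m + 2, hence p q ≥ m² / 4, while
-- (1 − ε) n ≤ m.  Distinct phases require k − 1 ≤ p; if k is too large for this, then
-- m² (k − 2) increases when k decreases, and surplus carriers may duplicate other ones.

module Submission where

open import Defs
open import Data.Nat using (ℕ; zero; suc; NonZero)
open import Data.Nat.DivMod using (_mod_)
open import Data.Fin using (Fin; zero; suc; toℕ; splitAt; join; _↑ˡ_)
open import Data.Fin.Properties using (toℕ-injective; toℕ<n; toℕ-fromℕ<; fromℕ<-cong; splitAt-join; join-splitAt; splitAt-↑ˡ)
open import Data.Integer using (+_)
open import Data.List using (List; []; _∷_; length; filter; allFin)
open import Data.List.Properties using (filter-all; length-tabulate)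
open import Data.List.Membership.Propositional using (_∈_)
open import Data.List.Membership.Propositional.Properties using (∈-filter⁻; ∈-allFin)
open import Data.List.Relation.Unary.Any using (here; there)
open import Data.List.Relation.Unary.AllPairs using (_∷_)
open import Data.List.Relation.Unary.Unique.Propositional using (Unique)
open import Data.List.Relation.Unary.Unique.Propositional.Properties using (filter⁺; allFin⁺)
open import Data.Rational using (ℚ; _/_; 0ℚ; 1ℚ; _-_; _*_; _<_; _≤_)
open import Data.Product using (Σ; ∃; ∃₂; _×_; _,_; proj₁; proj₂)
open import Data.Sum using (_⊎_; inj₁; inj₂; map₂; [_,_]′)
open import Data.Sum.Properties using (inj₁-injective)
open import Function using (_∘_; id; const)
open import Function.Definitions using (Injective)
open import Relation.Nullary using (¬_; yes; no; ¬?; contradiction)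
open import Relation.Binary.PropositionalEquality
import Data.Fin.Properties as Fin
import Data.Nat as ℕ
import Data.Nat.Properties as ℕ
import Data.Nat.DivMod as ℕ
import Data.Nat.Divisibility as ℕ
import Data.Nat.Coprimality as Coprime
import Data.Integer as ℤ
import Data.Integer.Properties as ℤ
import Data.Rational as ℚ
import Data.Rational.Properties as ℚ
import Data.Rational.Unnormalised as ℚᵘ
import Data.Rational.Unnormalised.Properties as ℚᵘ
import Data.Rational.Solver as ℚ
open import Data.Nat.Divisibility using (_∣_; divides)
open import Data.Nat.Tactic.RingSolver using (solve-∀)

-- Residues

%-≡⇒∣∸ : ∀ a b d .{{_ : NonZero d}} → a ℕ.% d ≡ b ℕ.% d → d ∣ b ℕ.∸ a
%-≡⇒∣∸ a b d eq = divides (b ℕ./ d ℕ.∸ a ℕ./ d) (begin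
  b ℕ.∸ a
    ≡⟨ cong₂ ℕ._∸_ (ℕ.m≡m%n+[m/n]*n b d) (ℕ.m≡m%n+[m/n]*n a d) ⟩
  (b ℕ.% d ℕ.+ b ℕ./ d ℕ.* d) ℕ.∸ (a ℕ.% d ℕ.+ a ℕ./ d ℕ.* d)
    ≡⟨ cong (λ z → (b ℕ.% d ℕ.+ b ℕ./ d ℕ.* d) ℕ.∸ (z ℕ.+ a ℕ./ d ℕ.* d)) eq ⟩
  (b ℕ.% d ℕ.+ b ℕ./ d ℕ.* d) ℕ.∸ (b ℕ.% d ℕ.+ a ℕ./ d ℕ.* d)
    ≡⟨ ℕ.[m+n]∸[m+o]≡n∸o (b ℕ.% d) _ _ ⟩
  b ℕ./ d ℕ.* d ℕ.∸ a ℕ./ d ℕ.* d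
    ≡⟨ ℕ.*-distribʳ-∸ d (b ℕ./ d) (a ℕ./ d) ⟨
  (b ℕ./ d ℕ.∸ a ℕ./ d) ℕ.* d ∎)
  where open ≡-Reasoning

-- Otherwise `d` would divide `b ∸ a`, which is positive and less than `d`.
%-shift-≡⇒≥ : ∀ c a b d .{{_ : NonZero d}} →
              (c ℕ.+ a) ℕ.% d ≡ (c ℕ.+ b) ℕ.% d → b ℕ.< d → b ℕ.≤ a
%-shift-≡⇒≥ c a b d eq b<d with b ℕ.≤? a
... | yes b≤a = b≤a
... | no  b≰a = contradiction
  (ℕ.≤-trans (ℕ.∣⇒≤ {{ℕ.>-nonZero (ℕ.m<n⇒0<n∸m (ℕ.≰⇒> b≰a))}} d∣b∸a) (ℕ.m∸n≤m b a))
  (ℕ.<⇒≱ b<d)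
  where
  d∣b∸a : d ∣ b ℕ.∸ a
  d∣b∸a = subst (d ∣_) (ℕ.[m+n]∸[m+o]≡n∸o c b a) (%-≡⇒∣∸ (c ℕ.+ a) (c ℕ.+ b) d eq)

%-shift-injective : ∀ c a b d .{{_ : NonZero d}} →
                    (c ℕ.+ a) ℕ.% d ≡ (c ℕ.+ b) ℕ.% d → a ℕ.< d → b ℕ.< d → a ≡ b
%-shift-injective c a b d eq a<d b<d =
  ℕ.≤-antisym (%-shift-≡⇒≥ c b a d (sym eq) a<d) (%-shift-≡⇒≥ c a b d eq b<d)

%-congˡ-+ : ∀ c {a b} d .{{_ : NonZero d}} →
            a ℕ.% d ≡ b ℕ.% d → (c ℕ.+ a) ℕ.% d ≡ (c ℕ.+ b) ℕ.% d
%-congˡ-+ c {a} {b} d eq = begin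
  (c ℕ.+ a) ℕ.% d                 ≡⟨ ℕ.%-distribˡ-+ c a d ⟩
  (c ℕ.% d ℕ.+ a ℕ.% d) ℕ.% d     ≡⟨ cong (λ z → (c ℕ.% d ℕ.+ z) ℕ.% d) eq ⟩
  (c ℕ.% d ℕ.+ b ℕ.% d) ℕ.% d     ≡⟨ ℕ.%-distribˡ-+ c b d ⟨
  (c ℕ.+ b) ℕ.% d                 ∎
  where open ≡-Reasoning

toℕ-mod : ∀ a d .{{_ : NonZero d}} → toℕ (a mod d) ≡ a ℕ.% d
toℕ-mod a d = toℕ-fromℕ< (ℕ.m%n<n a d)

mod-cong : ∀ a b d .{{_ : NonZero d}} → a ℕ.% d ≡ b ℕ.% d → a mod d ≡ b mod d
mod-cong a b d eq = fromℕ<-cong _ _ eq (ℕ.m%n<n a d) (ℕ.m%n<n b d)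

mod-≡⇒%-≡ : ∀ a b d .{{_ : NonZero d}} → a mod d ≡ b mod d → a ℕ.% d ≡ b ℕ.% d
mod-≡⇒%-≡ a b d eq = trans (sym (toℕ-mod a d)) (trans (cong toℕ eq) (toℕ-mod b d))

toℕ[a]-mod : ∀ {d} (a : Fin d) .{{_ : NonZero d}} → toℕ a mod d ≡ a
toℕ[a]-mod {d} a =
  toℕ-injective (trans (toℕ-mod (toℕ a) d) (ℕ.m<n⇒m%n≡m (toℕ<n a)))

-- Routes and walks

-- The edges are distinct because their tails are, and a period of at least 2 rules out loops.
injective⇒irredundant : ∀ {n k} (G : PV n k) (c : Fin k) → 2 ℕ.≤ period G c →
                        Injective _≡_ _≡_ (route G c) → IrredundantRoute G c
injective⇒irredundant G c 2≤p inj = (moves-on , λ i j eq _ → same-index i j eq) , inj₁ inj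
  where
  p = period G c
  instance
    p≢0 : NonZero p
    p≢0 = period-nz G c

  moves-on : ∀ (i : Fin p) → pos G c (toℕ i) ≢ pos G c (suc (toℕ i))
  moves-on i eq = contradiction (%-shift-≡⇒≥ (toℕ i) 0 1 p eq′ 2≤p) λ ()
    where
    eq′ : (toℕ i ℕ.+ 0) ℕ.% p ≡ (toℕ i ℕ.+ 1) ℕ.% p
    eq′ = subst₂ (λ a b → a ℕ.% p ≡ b ℕ.% p)
      (ℕ.+-comm 0 (toℕ i)) (ℕ.+-comm 1 (toℕ i)) (mod-≡⇒%-≡ _ _ p (inj eq))

  same-index : ∀ (i j : Fin p) → pos G c (toℕ i) ≡ pos G c (toℕ j) → i ≡ j
  same-index i j eq = trans (sym (toℕ[a]-mod i)) (trans (inj eq) (toℕ[a]-mod j))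

-- Generalises `CoveringWalk` to any starting time and any list of sites, so that tours can be
-- composed by recursion on the list.
Cover : ∀ {n k} (G : PV n k) → ℕ → Fin n → List (Fin n) → Set
Cover G t y xs = Σ (Walk G t y) λ w → ∀ {s} → s ∈ xs → s ∈ visited w

start∈visited : ∀ {n k} {G : PV n k} {t y} (w : Walk G t y) → y ∈ visited w
start∈visited halt         = here refl
start∈visited (move _ _ _) = here refl

module _ {n k} {G : PV n k} (c : Fin k) where

  board : ∀ {T xs} → Cover G (suc T) (pos G c (suc T)) xs → Cover G T (pos G c T) xs
  board (w , cov) = move c refl w , there ∘ cov

  -- Walks grow at their beginning, so the induction lowers the upper end `T`, as `≤′` does.
  ride′ : ∀ {t T xs} → t ℕ.≤′ T → Cover G T (pos G c T) xs → Cover G t (pos G c t) xs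
  ride′ (ℕ.≤′-reflexive refl) w = w
  ride′ (ℕ.≤′-step t≤T)       w = ride′ t≤T (board w)

  ride : ∀ {t T xs} → t ℕ.≤ T → Cover G T (pos G c T) xs → Cover G t (pos G c t) xs
  ride t≤T = ride′ (ℕ.≤⇒≤′ t≤T)

  arrive : ∀ {t xs} → Cover G t (pos G c t) xs → Cover G t (pos G c t) (pos G c t ∷ xs)
  arrive (w , cov) = w , λ { (here refl) → start∈visited w ; (there s∈xs) → cov s∈xs }

  ride-through : ∀ {t τ T xs} → t ℕ.≤ τ → τ ℕ.≤ T →
                 Cover G T (pos G c T) xs → Cover G t (pos G c t) (pos G c τ ∷ xs)
  ride-through t≤τ τ≤T w = ride t≤τ (arrive (ride τ≤T w))

-- The conclusion of the theorem with a natural number as bound, which keeps `ε` out of the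
-- construction.
Hard : ℕ → ℕ → ℕ → Set
Hard n k B = Σ (PV n k) λ G → Heterogeneous G × Irredundant G × Feasible G ×
  ((σ : Strategy G) → Σ _ λ y → Σ (IsStart G y) λ st → B ℕ.< moves (proj₁ (σ y st)))

-- Without duplicates, `i` occurs at most once.
length-filter-≢ : ∀ {m} (i : Fin m) {xs} → Unique xs →
                  length xs ℕ.≤ suc (length (filter (λ x → ¬? (i Fin.≟ x)) xs))
length-filter-≢ i {[]} _ = ℕ.z≤n
length-filter-≢ i {x ∷ xs} (x∉xs ∷ u) with i Fin.≟ x
... | yes refl = ℕ.s≤s (ℕ.≤-reflexive (cong length (sym (filter-all (λ x → ¬? (i Fin.≟ x)) x∉xs))))
... | no  _    = ℕ.s≤s (length-filter-≢ i u)

-- The star of a hub and suc J leaves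

module Star
  (ρ J S : ℕ)
  -- Leaf `i` has phase `i`; the bound makes the phases distinct modulo the leaf period.
  (J<p : J ℕ.< 3 ℕ.+ ρ)
  -- `g i j` is the shared site at index `2 + j` on the route of leaf `i`; `g⁻¹` recovers `j` from
  -- the site alone.
  (g : Fin (suc J) → Fin (suc ρ) → Fin S)
  (g⁻¹ : Fin S → Fin (suc ρ))
  (g⁻¹-g : ∀ i j → g⁻¹ (g i j) ≡ j)
  (g-onto : ∀ x → ∃₂ λ i j → g i j ≡ x)
  (k : ℕ)
  -- Carrier `c` plays the role `κ c`, where `zero` is the hub; carriers of equal role are copies,
  -- and `sec` picks one for each role.
  (κ : Fin k → Fin (2 ℕ.+ J))
  (sec : Fin (2 ℕ.+ J) → Fin k)
  (κ-sec : ∀ b → κ (sec b) ≡ b)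
  where

  q p n P : ℕ
  q = 2 ℕ.+ ρ
  p = 3 ℕ.+ ρ
  n = q ℕ.+ (suc J ℕ.+ S)
  P = p ℕ.* q

  -- Sites and routes of the star

  Site : Set
  Site = Fin q ⊎ (Fin (suc J) ⊎ Fin S)

  pattern hub x    = inj₁ x
  pattern own i    = inj₂ (inj₁ i)
  pattern shared x = inj₂ (inj₂ x)

  enc : Site → Fin n
  enc s = join q _ (map₂ (join (suc J) S) s)

  dec : Fin n → Site
  dec x = map₂ (splitAt (suc J)) (splitAt q x)

  dec-enc : ∀ s → dec (enc s) ≡ s
  dec-enc s rewrite splitAt-join q _ (map₂ (join (suc J) S) s) with s
  ... | inj₁ _ = refl
  ... | inj₂ s = cong inj₂ (splitAt-join (suc J) S s)

  enc-dec : ∀ x → enc (dec x) ≡ x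
  enc-dec x = trans (cong (join q _) (lemma (splitAt q x))) (join-splitAt q _ x)
    where
    lemma : ∀ s → map₂ (join (suc J) S) (map₂ (splitAt (suc J)) s) ≡ s
    lemma (inj₁ _) = refl
    lemma (inj₂ s) = cong inj₂ (join-splitAt (suc J) S s)

  enc-injective : ∀ {s s′} → enc s ≡ enc s′ → s ≡ s′
  enc-injective {s} {s′} eq = trans (sym (dec-enc s)) (trans (cong dec eq) (dec-enc s′))

  leafSite : Fin (suc J) → Fin p → Site
  leafSite i zero          = hub zero
  leafSite i (suc zero)    = own i
  leafSite i (suc (suc j)) = shared (g i j)

  -- Every site has the same index on all the leaf routes through it, so leaves
  -- at different phases never meet.
  index : Site → Fin p
  index (hub _)    = zero
  index (own _)    = suc zero
  index (shared x) = suc (suc (g⁻¹ x))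

  index-leafSite : ∀ i j → index (leafSite i j) ≡ j
  index-leafSite i zero          = refl
  index-leafSite i (suc zero)    = refl
  index-leafSite i (suc (suc j)) = cong (λ x → suc (suc x)) (g⁻¹-g i j)

  per : Fin (2 ℕ.+ J) → ℕ
  per zero    = q
  per (suc _) = p

  per-nz : ∀ b → NonZero (per b)
  per-nz zero    = _
  per-nz (suc _) = _

  site : Fin (2 ℕ.+ J) → ℕ → Site
  site zero    t = hub (t mod q)
  site (suc i) t = leafSite i ((toℕ i ℕ.+ t) mod p)

  site-cong : ∀ b {t t′} → let instance _ = per-nz b in
              t ℕ.% per b ≡ t′ ℕ.% per b → site b t ≡ site b t′
  site-cong zero    {t} {t′} eq = cong hub (mod-cong t t′ q eq)
  site-cong (suc i) {t} {t′} eq =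
    cong (leafSite i) (mod-cong (toℕ i ℕ.+ t) (toℕ i ℕ.+ t′) p (%-congˡ-+ (toℕ i) {t} {t′} p eq))

  G : PV n k
  G = record
    { period    = per ∘ κ
    ; period-nz = per-nz ∘ κ
    ; route     = λ c j → enc (site (κ c) (toℕ j))
    }

  pos≡ : ∀ c t → pos G c t ≡ enc (site (κ c) t)
  pos≡ c t = cong enc (site-cong (κ c)
    (trans (cong (ℕ._% per (κ c)) (toℕ-mod t (per (κ c)))) (ℕ.m%n%n≡m%n t (per (κ c)))))
    where instance _ = per-nz (κ c)

  pos-sec : ∀ b t → pos G (sec b) t ≡ enc (site b t)
  pos-sec b t = trans (pos≡ (sec b) t) (cong (λ b → enc (site b t)) (κ-sec b))

  -- On a leaf route `index` recovers the residue modulo `p`, and the shift by the phase is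
  -- injective on residues.
  site-injective : ∀ b (j j′ : Fin (per b)) → site b (toℕ j) ≡ site b (toℕ j′) → j ≡ j′
  site-injective zero    j j′ eq =
    trans (sym (toℕ[a]-mod j)) (trans (inj₁-injective eq) (toℕ[a]-mod j′))
  site-injective (suc i) j j′ eq = toℕ-injective
    (%-shift-injective (toℕ i) (toℕ j) (toℕ j′) p
      (mod-≡⇒%-≡ (toℕ i ℕ.+ toℕ j) (toℕ i ℕ.+ toℕ j′) p
        (trans (sym (index-leafSite i _)) (trans (cong index eq) (index-leafSite i _))))
      (toℕ<n j) (toℕ<n j′))

  irredundant : Irredundant G
  irredundant c = injective⇒irredundant G c (2≤per (κ c))
    (λ {j} {j′} eq → site-injective (κ c) j j′ (enc-injective eq))
    where
    2≤per : ∀ b → 2 ℕ.≤ per b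
    2≤per zero    = ℕ.s≤s (ℕ.s≤s ℕ.z≤n)
    2≤per (suc _) = ℕ.s≤s (ℕ.s≤s ℕ.z≤n)

  heterogeneous : Heterogeneous G
  heterogeneous = sec zero , sec (suc zero) ,
    λ eq → ℕ.<⇒≢ (ℕ.n<1+n q)
      (subst₂ (λ b b′ → per b ≡ per b′) (κ-sec zero) (κ-sec (suc zero)) eq)

  -- Periodicity and feasibility

  site-periodic : ∀ b t x → site b (t ℕ.+ x ℕ.* P) ≡ site b t
  site-periodic zero t x = site-cong zero {t ℕ.+ x ℕ.* P} {t}
    (trans (cong (λ z → (t ℕ.+ z) ℕ.% q) (sym (ℕ.*-assoc x p q))) (ℕ.[m+kn]%n≡m%n t (x ℕ.* p) q))
  site-periodic (suc i) t x = site-cong (suc i) {t ℕ.+ x ℕ.* P} {t}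
    (trans (cong (λ z → (t ℕ.+ z) ℕ.% p)
        (trans (cong (x ℕ.*_) (ℕ.*-comm p q)) (sym (ℕ.*-assoc x q p))))
      (ℕ.[m+kn]%n≡m%n t (x ℕ.* q) p))

  -- As p = q + 1, the time q i is 0 modulo q and − i modulo p.
  meetTime : Fin (2 ℕ.+ J) → ℕ
  meetTime zero    = 0
  meetTime (suc i) = toℕ i ℕ.* q

  -- The phase cancels because `i + i q = i p`: from time `i q` on, leaf `i` runs through its sites
  -- in order.
  site-leaf : ∀ i j → site (suc i) (toℕ i ℕ.* q ℕ.+ toℕ j) ≡ leafSite i j
  site-leaf i j = cong (leafSite i) (toℕ-injective (begin
    toℕ ((toℕ i ℕ.+ (toℕ i ℕ.* q ℕ.+ toℕ j)) mod p) ≡⟨ toℕ-mod (toℕ i ℕ.+ (toℕ i ℕ.* q ℕ.+ toℕ j)) p ⟩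
    (toℕ i ℕ.+ (toℕ i ℕ.* q ℕ.+ toℕ j)) ℕ.% p
      ≡⟨ cong (ℕ._% p) (rearrange (toℕ i) ρ (toℕ j)) ⟩
    (toℕ j ℕ.+ toℕ i ℕ.* p) ℕ.% p                   ≡⟨ ℕ.[m+kn]%n≡m%n (toℕ j) (toℕ i) p ⟩
    toℕ j ℕ.% p                                     ≡⟨ ℕ.m<n⇒m%n≡m (toℕ<n j) ⟩
    toℕ j                                           ∎))
    where
    open ≡-Reasoning
    rearrange : ∀ i ρ j → i ℕ.+ (i ℕ.* (2 ℕ.+ ρ) ℕ.+ j) ≡ j ℕ.+ i ℕ.* (3 ℕ.+ ρ)
    rearrange = solve-∀

  meet-at : ∀ b → site b (meetTime b) ≡ site zero (meetTime b)
  meet-at zero    = refl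
  meet-at (suc i) = trans
    (trans (cong (site (suc i)) (sym (ℕ.+-identityʳ _))) (site-leaf i zero))
    (site-cong zero {0} {toℕ i ℕ.* q} (sym (ℕ.m*n%n≡0 (toℕ i) q)))

  pos-meet : ∀ b x → let T = meetTime b ℕ.+ x ℕ.* P in
             pos G (sec b) T ≡ pos G (sec zero) T
  pos-meet b x = trans (pos-sec b _) (trans (cong enc
    (trans (site-periodic b _ x) (trans (meet-at b) (sym (site-periodic zero (meetTime b) x)))))
    (sym (pos-sec zero _)))

  locate : ∀ s → ∃₂ λ b τ → site b τ ≡ s
  locate (hub x)    = zero , toℕ x , cong hub (toℕ[a]-mod x)
  locate (own i)    = suc i , _ , site-leaf i (suc zero)
  locate (shared x) with g-onto x
  ... | i , j , refl = suc i , _ , site-leaf i (suc (suc j))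

  m≤m*P : ∀ m → m ℕ.≤ m ℕ.* P
  m≤m*P m = ℕ.m≤m*n m P

  -- Three rides: on the hub to a meeting with a carrier that serves `s`, on that carrier through
  -- `s` to a later meeting, then on the hub again.
  visit : ∀ s {xs} → (∀ T → Cover G T (pos G (sec zero) T) xs) →
          ∀ t → Cover G t (pos G (sec zero) t) (s ∷ xs)
  visit s {xs} cov t with locate (dec s)
  ... | b , τ , eq = ride (sec zero) t≤T₁
      (subst (λ y → Cover G T₁ y (s ∷ xs)) (pos-meet b t)
        (subst (λ z → Cover G T₁ (pos G (sec b) T₁) (z ∷ xs)) at-s
          (ride-through (sec b) T₁≤τ′ τ′≤T₂
            (subst (λ y → Cover G T₂ y xs) (sym (pos-meet b (τ ℕ.+ (M ℕ.+ t)))) (cov T₂)))))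
    where
    M = meetTime b
    -- `P` is positive and a period of all carriers, so multiples of it postpone each event past the
    -- previous one; the multipliers collect the earlier offsets.
    T₁ = M ℕ.+ t ℕ.* P
    τ′ = τ ℕ.+ (M ℕ.+ t) ℕ.* P
    T₂ = M ℕ.+ (τ ℕ.+ (M ℕ.+ t)) ℕ.* P

    t≤T₁ : t ℕ.≤ T₁
    t≤T₁ = ℕ.≤-trans (m≤m*P t) (ℕ.m≤n+m _ M)

    T₁≤τ′ : T₁ ℕ.≤ τ′
    T₁≤τ′ = ℕ.≤-trans (ℕ.+-monoˡ-≤ (t ℕ.* P) (m≤m*P M))
      (ℕ.≤-trans (ℕ.≤-reflexive (sym (ℕ.*-distribʳ-+ P M t))) (ℕ.m≤n+m _ τ))

    τ′≤T₂ : τ′ ℕ.≤ T₂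
    τ′≤T₂ = ℕ.≤-trans (ℕ.+-monoˡ-≤ _ (m≤m*P τ))
      (ℕ.≤-trans (ℕ.≤-reflexive (sym (ℕ.*-distribʳ-+ P τ (M ℕ.+ t)))) (ℕ.m≤n+m _ M))

    at-s : pos G (sec b) τ′ ≡ s
    at-s = trans (pos-sec b τ′)
      (trans (cong enc (trans (site-periodic b τ (M ℕ.+ t)) eq)) (enc-dec s))

  tour : ∀ xs t → Cover G t (pos G (sec zero) t) xs
  tour []       t = halt , λ ()
  tour (x ∷ xs) t = visit x (tour xs) t

  feasible : Feasible G
  feasible y (c , refl) = proj₁ w , λ s → proj₂ w (∈-allFin s)
    where
    b = κ c
    -- The initial carrier is ridden to a meeting with the hub, where the tour begins; `0 * P` gives
    -- `T` the form used in `pos-meet`.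
    T = meetTime b ℕ.+ 0 ℕ.* P
    w : Cover G 0 (pos G c 0) (allFin n)
    w = ride c ℕ.z≤n (subst (λ y → Cover G T y (allFin n))
      (trans (sym (pos-meet b 0)) (trans (pos-sec b T) (sym (pos≡ c T)))) (tour (allFin n) T))

  -- Meetings of carriers

  Meet : Fin (suc J) → ℕ → Set
  Meet i t = site zero t ≡ site (suc i) t

  leafSite-hub : ∀ i j {x} → hub x ≡ leafSite i j → x ≡ zero × j ≡ zero
  leafSite-hub i zero          refl = refl , refl
  leafSite-hub i (suc zero)    ()
  leafSite-hub i (suc (suc _)) ()

  leafSite-own : ∀ i j {x} → own x ≡ leafSite i j → x ≡ i
  leafSite-own i (suc zero) refl = refl

  meet-residues : ∀ i {t} → Meet i t → t ℕ.% q ≡ 0 × (toℕ i ℕ.+ t) ℕ.% p ≡ 0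
  meet-residues i {t} eq with leafSite-hub i _ eq
  ... | e₁ , e₂ = trans (sym (toℕ-mod t q)) (cong toℕ e₁) ,
                  trans (sym (toℕ-mod (toℕ i ℕ.+ t) p)) (cong toℕ e₂)

  p-coprime-q : Coprime.Coprime p q
  p-coprime-q = subst (λ z → Coprime.Coprime z q) (ℕ.+-comm q 1)
    (Coprime.coprime-+ (Coprime.1-coprimeTo q))

  -- Both `q` and `p` divide the positive difference; being coprime, so does their product.
  meet-gap : ∀ i {t t′} → Meet i t → Meet i t′ → t ℕ.< t′ → P ℕ.≤ t′ ℕ.∸ t
  meet-gap i {t} {t′} m m′ t<t′
    with meet-residues i m | meet-residues i m′
  ... | tq , tp | t′q , t′p
    with %-≡⇒∣∸ t t′ q (trans tq (sym t′q))
  ... | divides x eq = ℕ.∣⇒≤ {{ℕ.>-nonZero (ℕ.m<n⇒0<n∸m t<t′)}}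
      (subst (P ∣_) (sym eq) (ℕ.*-monoˡ-∣ q p∣x))
    where
    p∣t′∸t : p ∣ t′ ℕ.∸ t
    p∣t′∸t = subst (p ∣_) (ℕ.[m+n]∸[m+o]≡n∸o (toℕ i) t′ t)
      (%-≡⇒∣∸ (toℕ i ℕ.+ t) (toℕ i ℕ.+ t′) p (trans tp (sym t′p)))
    p∣x : p ∣ x
    p∣x = Coprime.coprime-divisor p-coprime-q
      (subst (p ∣_) (trans eq (ℕ.*-comm x q)) p∣t′∸t)

  leaves-apart : ∀ i i′ {t} → site (suc i) t ≡ site (suc i′) t → i ≡ i′
  leaves-apart i i′ {t} eq = toℕ-injective
    (%-shift-injective t (toℕ i) (toℕ i′) p eq′ (bound i) (bound i′))
    where
    bound : ∀ i → toℕ {suc J} i ℕ.< p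
    bound i = ℕ.≤-trans (toℕ<n i) J<p
    eq′ : (t ℕ.+ toℕ i) ℕ.% p ≡ (t ℕ.+ toℕ i′) ℕ.% p
    eq′ = subst₂ (λ a b → a ℕ.% p ≡ b ℕ.% p) (ℕ.+-comm (toℕ i) t) (ℕ.+-comm (toℕ i′) t)
      (mod-≡⇒%-≡ (toℕ i ℕ.+ t) (toℕ i′ ℕ.+ t) p
        (trans (sym (index-leafSite i _)) (trans (cong index eq) (index-leafSite i′ _))))

  -- Lower bound on the number of moves

  Visits : ∀ {t y} → Walk G t y → List (Fin (suc J)) → Set
  Visits w U = ∀ {x} → x ∈ U → enc (own x) ∈ visited w

  skip-head : ∀ {y U} {ys : List (Fin n)} → (∀ {x} → x ∈ U → enc (own x) ≢ y) →
              (∀ {x} → x ∈ U → enc (own x) ∈ y ∷ ys) → ∀ {x} → x ∈ U → enc (own x) ∈ ys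
  skip-head ≢y vis x∈U with vis x∈U
  ... | here eq  = contradiction eq (≢y x∈U)
  ... | there ∈ys = ∈ys

  nonempty : ∀ {U : List (Fin (suc J))} {u} → u ℕ.< length U → ∃ (_∈ U)
  nonempty {x ∷ U} _ = x , here refl

  own≢hub : ∀ {y t} → y ≡ enc (site zero t) → ∀ {x} → enc (own x) ≢ y
  own≢hub {t = t} refl {x} eq with enc-injective {own x} {site zero t} eq
  ... | ()

  own≢leaf : ∀ {y t i U} → y ≡ enc (site (suc i) t) → (∀ {x} → x ∈ U → i ≢ x) →
             ∀ {x} → x ∈ U → enc (own x) ≢ y
  own≢leaf {t = t} {i} refl i∉U {x} x∈U eq =
    i∉U x∈U (sym (leafSite-own i _ (enc-injective {own x} {site (suc i) t} eq)))

  -- Turns a legal move into a meeting: the agent, at the site of role `b`, boards a carrier of role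
  -- `b′`.
  carrier-site : ∀ {c t y b} b′ → κ c ≡ b′ → y ≡ enc (site b t) → pos G c t ≡ y → site b t ≡ site b′ t
  carrier-site {c} {t} b′ refl y≡ at =
    enc-injective (trans (sym y≡) (trans (sym at) (pos≡ c t)))

  -- A visit to own i from the hub lasts a full P, since it begins and ends at a
  -- meeting of leaf i with the hub; e counts the time left to the end of the visit.
  mutual
    hub-bound : ∀ {t y} (w : Walk G t y) → y ≡ enc (site zero t) →
                ∀ {U} → Unique U → Visits w U → ∀ {u} → u ℕ.< length U → u ℕ.* P ℕ.< moves w
    hub-bound {t} halt at {U} _ vis u< with nonempty {U} u<
    ... | x , x∈U with vis x∈U
    ... | here eq = contradiction eq (own≢hub {t = t} at)
    hub-bound {t} (move c c-at w) at {U} uniq vis {u} u< = step (κ c) refl u u<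
      where
      vis′ : Visits w U
      vis′ = skip-head (λ _ → own≢hub {t = t} at) vis
      step : ∀ b → κ c ≡ b → ∀ u → u ℕ.< length U → u ℕ.* P ℕ.< suc (moves w)
      step zero κc≡ u u< = ℕ.m<n⇒m<1+n
        (hub-bound w (trans (pos≡ c _) (cong (λ b → enc (site b (suc t))) κc≡)) uniq vis′ u<)
      step (suc i) κc≡ zero    u< = ℕ.s≤s ℕ.z≤n
      step (suc i) κc≡ (suc u) u< = ℕ.s≤s
        (leaf-bound w i (trans (pos≡ c _) (cong (λ b → enc (site b (suc t))) κc≡))
          -- Leaf `i` is struck off; at most one entry goes, which matches the passage from `suc u`
          -- to `u`.
          (filter⁺ i≢? uniq)
          (λ x∈ → proj₂ (∈-filter⁻ i≢? {xs = U} x∈))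
          (λ x∈ → vis′ (proj₁ (∈-filter⁻ i≢? {xs = U} x∈)))
          {u} (ℕ.s≤s⁻¹ (ℕ.≤-trans u< (length-filter-≢ i uniq)))
          -- The boarding move accounts for one of the `P` time units.
          (ℕ.pred P) apart)
        where
        i≢? = λ x → ¬? (i Fin.≟ x)
        met : Meet i t
        met = carrier-site {c} {t} {b = zero} (suc i) κc≡ at c-at
        apart : ∀ t′ → suc t ℕ.≤ t′ → t′ ℕ.< suc t ℕ.+ ℕ.pred P → ¬ Meet i t′
        apart t′ t<t′ t′< m = ℕ.<⇒≱ t′<
          (ℕ.≤-trans (ℕ.≤-reflexive (sym (ℕ.+-suc t (ℕ.pred P))))
            (ℕ.≤-trans (ℕ.+-monoʳ-≤ t (meet-gap i {t} {t′} met m t<t′))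
              (ℕ.≤-reflexive (ℕ.m+[n∸m]≡n (ℕ.<⇒≤ t<t′)))))

    leaf-bound : ∀ {t y} (w : Walk G t y) i → y ≡ enc (site (suc i) t) →
                 ∀ {U} → Unique U → (∀ {x} → x ∈ U → i ≢ x) → Visits w U →
                 ∀ {u} → u ℕ.< length U →
                 ∀ e → (∀ t′ → t ℕ.≤ t′ → t′ ℕ.< t ℕ.+ e → ¬ Meet i t′) → e ℕ.+ u ℕ.* P ℕ.< moves w
    leaf-bound {t} halt i at {U} _ i∉U vis u< e _ with nonempty {U} u<
    ... | x , x∈U with vis x∈U
    ... | here eq = contradiction eq (own≢leaf {t = t} {U = U} at i∉U x∈U)
    leaf-bound {t} (move c c-at w) i at {U} uniq i∉U vis {u} u< e apart = step (κ c) refl e apart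
      where
      vis′ : Visits w U
      vis′ = skip-head (own≢leaf {t = t} {U = U} at i∉U) vis
      step : ∀ b → κ c ≡ b → ∀ e → (∀ t′ → t ℕ.≤ t′ → t′ ℕ.< t ℕ.+ e → ¬ Meet i t′) →
             e ℕ.+ u ℕ.* P ℕ.< suc (moves w)
      step zero κc≡ zero _ = ℕ.m<n⇒m<1+n
        (hub-bound w (trans (pos≡ c _) (cong (λ b → enc (site b (suc t))) κc≡)) uniq vis′ u<)
      -- Boarding the hub now would be a meeting with leaf `i` before the visit can end.
      step zero κc≡ (suc e) apart = contradiction
        (sym (carrier-site {c} {t} {b = suc i} zero κc≡ at c-at))
        (apart t ℕ.≤-refl (ℕ.m<m+n t (ℕ.s≤s ℕ.z≤n)))
      -- No other leaf is at this site, so the agent stays on leaf `i`, and each move uses up one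
      -- unit of `e`.
      step (suc i′) κc≡ e apart
        with leaves-apart i i′ {t} (carrier-site {c} {t} {b = suc i} (suc i′) κc≡ at c-at)
      ... | refl = stay e apart
        where
        rest : ∀ e → (∀ t′ → suc t ℕ.≤ t′ → t′ ℕ.< suc t ℕ.+ e → ¬ Meet i t′) → e ℕ.+ u ℕ.* P ℕ.< moves w
        rest = leaf-bound w i (trans (pos≡ c _) (cong (λ b → enc (site b (suc t))) κc≡))
          uniq i∉U vis′ u<
        stay : ∀ e → (∀ t′ → t ℕ.≤ t′ → t′ ℕ.< t ℕ.+ e → ¬ Meet i t′) →
               e ℕ.+ u ℕ.* P ℕ.< suc (moves w)
        stay zero    _     = ℕ.m<n⇒m<1+n (rest zero λ t′ t<t′ t′< →
          contradiction t<t′ (ℕ.<⇒≱ (subst (t′ ℕ.<_) (ℕ.+-identityʳ (suc t)) t′<)))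
        stay (suc e) apart = ℕ.s≤s (rest e λ t′ t<t′ t′< →
          apart t′ (ℕ.<⇒≤ t<t′) (subst (t′ ℕ.<_) (sym (ℕ.+-suc t e)) t′<))

  -- Of the `suc J` own sites the last needs no return to the hub, so `J` full periods `P` are
  -- counted.
  hard : Hard n k (J ℕ.* P)
  hard = G , heterogeneous , irredundant , feasible , λ σ →
    pos G (sec zero) 0 , (sec zero , refl) ,
    hub-bound (proj₁ (σ _ _)) (pos-sec zero 0) (allFin⁺ (suc J))
      (λ _ → proj₂ (σ _ _) _) (ℕ.≤-reflexive (sym (length-tabulate {n = suc J} id)))

-- An n-cycle together with 2-cycles, for the degenerate parameters

module Wheel (ν j : ℕ) where

  n : ℕ
  n = 3 ℕ.+ ν

  G : PV n (2 ℕ.+ j)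
  G = record
    { period    = λ { zero → n ; (suc _) → 2 }
    ; period-nz = λ { zero → _ ; (suc _) → _ }
    -- The 2-cycles all run on the first two sites, so every carrier starts at site `zero`.
    ; route     = λ { zero → id ; (suc _) → _↑ˡ suc ν }
    }

  heterogeneous : Heterogeneous G
  heterogeneous = zero , suc zero , λ ()

  irredundant : Irredundant G
  irredundant zero    = injective⇒irredundant G zero (ℕ.s≤s (ℕ.s≤s ℕ.z≤n)) id
  irredundant (suc c) = injective⇒irredundant G (suc c) ℕ.≤-refl
    (Fin.↑ˡ-injective (suc ν) _ _)

  tour : ∀ xs t → Cover G t (pos G zero t) xs
  tour []       t = halt , λ ()
  tour (x ∷ xs) t = subst (λ z → Cover G t (pos G zero t) (z ∷ xs)) at-x
    (ride-through zero t≤τ ℕ.≤-refl (tour xs τ))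
    where
    τ = toℕ x ℕ.+ t ℕ.* n
    t≤τ : t ℕ.≤ τ
    t≤τ = ℕ.≤-trans (ℕ.m≤m*n t n) (ℕ.m≤n+m _ (toℕ x))
    at-x : pos G zero τ ≡ x
    at-x = trans (mod-cong τ (toℕ x) n (ℕ.[m+kn]%n≡m%n (toℕ x) t n)) (toℕ[a]-mod x)

  origin-covers : CoveringWalk G zero
  origin-covers = proj₁ w , λ s → proj₂ w (∈-allFin s)
    where w = tour (allFin n) 0

  feasible : Feasible G
  feasible y (zero  , refl) = origin-covers
  feasible y (suc c , refl) = origin-covers

  covering⇒moves : (w : CoveringWalk G zero) → 0 ℕ.< moves (proj₁ w)
  covering⇒moves (halt , cov) with cov (suc zero)
  ... | here ()
  ... | there ()
  covering⇒moves (move _ _ _ , _) = ℕ.s≤s ℕ.z≤n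

  hard : Hard n (2 ℕ.+ j) 0
  hard = G , heterogeneous , irredundant , feasible ,
    λ σ → zero , (zero , refl) , covering⇒moves (σ zero (zero , refl))

-- Choosing the parameters

-- The `d` surplus carriers take role `zero`, that is, they become copies of the hub.
collapse : ∀ a d → Fin (suc a ℕ.+ d) → Fin (suc a)
collapse a d c = [ id , const zero ]′ (splitAt (suc a) c)

collapse-↑ˡ : ∀ a d b → collapse a d (b ↑ˡ d) ≡ b
collapse-↑ˡ a d b = cong [ id , const zero ]′ (splitAt-↑ˡ (suc a) b d)

-- With `m = 2 (suc ρ)`, the hub period is `m / 2 + 1`, and all leaves use the same `suc ρ` shared
-- sites.
star-even : ∀ ρ j d → j ℕ.< 3 ℕ.+ ρ →
            Hard (2 ℕ.+ (j ℕ.+ 2 ℕ.* suc ρ)) (2 ℕ.+ j ℕ.+ d) (j ℕ.* ((3 ℕ.+ ρ) ℕ.* (2 ℕ.+ ρ)))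
star-even ρ j d j<p = subst (λ n → Hard n (2 ℕ.+ j ℕ.+ d) (j ℕ.* ((3 ℕ.+ ρ) ℕ.* (2 ℕ.+ ρ)))) (count ρ j) (Star.hard ρ j (suc ρ) j<p
  (λ _ x → x) id (λ _ _ → refl) (λ x → zero , x , refl) _
  (collapse (suc j) d) (_↑ˡ d) (collapse-↑ˡ (suc j) d))
  where
  count : ∀ ρ j → (2 ℕ.+ ρ) ℕ.+ (suc j ℕ.+ suc ρ) ≡ 2 ℕ.+ (j ℕ.+ 2 ℕ.* suc ρ)
  count = solve-∀

-- With an odd number of free sites, leaf 0 trades one shared site for the left-over one;
-- a second leaf is needed to reach the traded site.
star-odd : ∀ ρ j d → suc j ℕ.< 3 ℕ.+ ρ →
           Hard (2 ℕ.+ (suc j ℕ.+ suc (2 ℕ.* suc ρ))) (2 ℕ.+ suc j ℕ.+ d)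
                (suc j ℕ.* ((3 ℕ.+ ρ) ℕ.* (2 ℕ.+ ρ)))
star-odd ρ j d j<p = subst (λ n → Hard n (2 ℕ.+ suc j ℕ.+ d) (suc j ℕ.* ((3 ℕ.+ ρ) ℕ.* (2 ℕ.+ ρ)))) (count ρ j) (Star.hard ρ (suc j) (2 ℕ.+ ρ) j<p
  g g⁻¹ g⁻¹-g g-onto _
  (collapse (2 ℕ.+ j) d) (_↑ˡ d) (collapse-↑ˡ (2 ℕ.+ j) d))
  where
  count : ∀ ρ j → (2 ℕ.+ ρ) ℕ.+ (2 ℕ.+ j ℕ.+ (2 ℕ.+ ρ)) ≡ 2 ℕ.+ (suc j ℕ.+ suc (2 ℕ.* suc ρ))
  count = solve-∀
  g : Fin (2 ℕ.+ j) → Fin (suc ρ) → Fin (2 ℕ.+ ρ)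
  g zero zero = zero
  g _    x    = suc x
  g⁻¹ : Fin (2 ℕ.+ ρ) → Fin (suc ρ)
  g⁻¹ zero    = zero
  g⁻¹ (suc x) = x
  g⁻¹-g : ∀ i x → g⁻¹ (g i x) ≡ x
  g⁻¹-g zero    zero    = refl
  g⁻¹-g zero    (suc _) = refl
  g⁻¹-g (suc _) _       = refl
  g-onto : ∀ x → ∃₂ λ i y → g i y ≡ x
  g-onto zero    = zero , zero , refl
  g-onto (suc x) = suc zero , x , refl

parity : ∀ m → ∃ λ a → m ≡ 2 ℕ.* a ⊎ m ≡ suc (2 ℕ.* a)
parity zero    = 0 , inj₁ refl
parity (suc m) with parity m
... | a , inj₁ eq = a , inj₂ (cong suc eq)
... | a , inj₂ eq = suc a , inj₁ (trans (cong suc eq) (sym (ℕ.*-suc 2 a)))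

2j≤2a+1⇒j≤a : ∀ j a → 2 ℕ.* j ℕ.≤ suc (2 ℕ.* a) → j ℕ.≤ a
2j≤2a+1⇒j≤a j a le with j ℕ.≤? a
... | yes j≤a = j≤a
... | no  j≰a = contradiction
  (ℕ.≤-trans (ℕ.≤-reflexive (sym (ℕ.*-suc 2 a))) (ℕ.*-monoʳ-≤ 2 (ℕ.≰⇒> j≰a))) (ℕ.≤⇒≯ le)

-- A walk with more than `j P` moves has at least `suc (j P)`; the extra one makes the comparison
-- strict even for `x = 4 P`.
*-<-4* : ∀ x j P → x ℕ.≤ 4 ℕ.* P → x ℕ.* j ℕ.< 4 ℕ.* suc (j ℕ.* P)
*-<-4* x j P le = begin-strict
  x ℕ.* j             ≤⟨ ℕ.*-monoˡ-≤ j le ⟩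
  4 ℕ.* P ℕ.* j       ≡⟨ trans (ℕ.*-assoc 4 P j) (cong (4 ℕ.*_) (ℕ.*-comm P j)) ⟩
  4 ℕ.* (j ℕ.* P)     <⟨ ℕ.*-monoʳ-< 4 (ℕ.n<1+n (j ℕ.* P)) ⟩
  4 ℕ.* suc (j ℕ.* P) ∎
  where open ℕ.≤-Reasoning

-- Here and below k = 2 + j + d and n = 2 + j + m.
hard-few-carriers : ∀ j m d → 2 ℕ.* j ℕ.≤ suc m → 1 ℕ.≤ m →
  ∃ λ B → m ℕ.* m ℕ.* j ℕ.< 4 ℕ.* suc B × Hard (2 ℕ.+ (j ℕ.+ m)) (2 ℕ.+ j ℕ.+ d) B
hard-few-carriers zero (suc m) d _ _ =
  0 , subst (ℕ._< 4) (sym (ℕ.*-zeroʳ (suc m ℕ.* suc m))) (ℕ.s≤s ℕ.z≤n) , Wheel.hard m d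
hard-few-carriers (suc j) m d few 1≤m with parity m
hard-few-carriers (suc j) m d few () | zero , inj₁ refl
-- `m = 1` is too small for a star, but here `m² j = 1` is below 4, so the bound 0 suffices.
hard-few-carriers (suc zero) m d few _ | zero , inj₂ refl =
  0 , ℕ.s≤s (ℕ.s≤s ℕ.z≤n) , Wheel.hard 1 (suc d)
hard-few-carriers (suc (suc j)) m d few _ | zero , inj₂ refl =
  contradiction (2j≤2a+1⇒j≤a (2 ℕ.+ j) 1 (ℕ.m≤n⇒m≤1+n few)) λ { (ℕ.s≤s ()) }
hard-few-carriers (suc j) m d few _ | suc ρ , inj₁ refl =
  _ , *-<-4* (m ℕ.* m) (suc j) P (ℕ.≤-trans (ℕ.m≤m+n _ _) (ℕ.≤-reflexive (slack ρ))) ,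
  star-even ρ (suc j) d (ℕ.≤-trans (ℕ.s≤s (2j≤2a+1⇒j≤a (suc j) (suc ρ) few)) (ℕ.n≤1+n _))
  where
  P = (3 ℕ.+ ρ) ℕ.* (2 ℕ.+ ρ)
  slack : ∀ ρ → 2 ℕ.* suc ρ ℕ.* (2 ℕ.* suc ρ) ℕ.+ (20 ℕ.+ 12 ℕ.* ρ) ≡ 4 ℕ.* ((3 ℕ.+ ρ) ℕ.* (2 ℕ.+ ρ))
  slack = solve-∀
hard-few-carriers (suc j) m d few _ | suc ρ , inj₂ refl =
  _ , *-<-4* (m ℕ.* m) (suc j) P (ℕ.≤-trans (ℕ.m≤m+n _ _) (ℕ.≤-reflexive (slack ρ))) ,
  star-odd ρ j d (ℕ.s≤s (2j≤2a+1⇒j≤a (suc j) (2 ℕ.+ ρ)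
    (ℕ.≤-trans few (ℕ.≤-trans (ℕ.≤-reflexive (sym (ℕ.*-suc 2 (suc ρ)))) (ℕ.n≤1+n _)))))
  where
  P = (3 ℕ.+ ρ) ℕ.* (2 ℕ.+ ρ)
  slack : ∀ ρ → suc (2 ℕ.* suc ρ) ℕ.* suc (2 ℕ.* suc ρ) ℕ.+ (15 ℕ.+ 8 ℕ.* ρ)
              ≡ 4 ℕ.* ((3 ℕ.+ ρ) ℕ.* (2 ℕ.+ ρ))
  slack = solve-∀

-- Twice the difference of the two sides is `(2 m + 1) 2 j − 2 m²`, and the hypothesis, which says
-- `m ≤ 2 j`, makes it at least `m`. Adding `(2 m + 1) (2 + m)` to both sides avoids subtraction.
m²j-mono : ∀ j m → suc m ℕ.< 2 ℕ.* suc j →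
           m ℕ.* m ℕ.* suc j ℕ.≤ suc m ℕ.* suc m ℕ.* j
m²j-mono j m many = ℕ.*-cancelˡ-≤ 2 (ℕ.+-cancelʳ-≤ (suc (2 ℕ.* m) ℕ.* (2 ℕ.+ m)) _ _ (begin
  2 ℕ.* (m ℕ.* m ℕ.* suc j) ℕ.+ suc (2 ℕ.* m) ℕ.* (2 ℕ.+ m)
    ≤⟨ ℕ.+-monoʳ-≤ _ (ℕ.*-monoʳ-≤ (suc (2 ℕ.* m)) many) ⟩
  2 ℕ.* (m ℕ.* m ℕ.* suc j) ℕ.+ suc (2 ℕ.* m) ℕ.* (2 ℕ.* suc j)
    ≤⟨ ℕ.m≤m+n _ m ⟩
  2 ℕ.* (m ℕ.* m ℕ.* suc j) ℕ.+ suc (2 ℕ.* m) ℕ.* (2 ℕ.* suc j) ℕ.+ m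
    ≡⟨ rearrange j m ⟩
  2 ℕ.* (suc m ℕ.* suc m ℕ.* j) ℕ.+ suc (2 ℕ.* m) ℕ.* (2 ℕ.+ m) ∎))
  where
  open ℕ.≤-Reasoning
  rearrange : ∀ j m →
    2 ℕ.* (m ℕ.* m ℕ.* suc j) ℕ.+ suc (2 ℕ.* m) ℕ.* (2 ℕ.* suc j) ℕ.+ m ≡
    2 ℕ.* (suc m ℕ.* suc m ℕ.* j) ℕ.+ suc (2 ℕ.* m) ℕ.* (2 ℕ.+ m)
  rearrange = solve-∀

-- If 2 j ≥ m + 2, then one carrier is better used as a copy of another one.
hard-exists : ∀ j m d → 1 ℕ.≤ m →
  ∃ λ B → m ℕ.* m ℕ.* j ℕ.< 4 ℕ.* suc B × Hard (2 ℕ.+ (j ℕ.+ m)) (2 ℕ.+ (j ℕ.+ d)) B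
hard-exists zero    m d 1≤m = hard-few-carriers zero m d ℕ.z≤n 1≤m
hard-exists (suc j) m d 1≤m with 2 ℕ.* suc j ℕ.≤? suc m
... | yes few = hard-few-carriers (suc j) m d few 1≤m
-- This keeps `n` and `k`: `j` drops by one while `m` and `d` grow by one.
... | no  ¬few with hard-exists j (suc m) (suc d) (ℕ.s≤s ℕ.z≤n)
...   | B , lt , h = B , ℕ.≤-<-trans (m²j-mono j m (ℕ.≰⇒> ¬few)) lt ,
  subst₂ (λ a b → Hard (2 ℕ.+ a) (2 ℕ.+ b) B) (ℕ.+-suc j m) (ℕ.+-suc j d) h

-- Passing to the rationals

ι : ℕ → ℚ
ι a = + a / 1

-- Identities for `ι` are checked on unnormalised fractions, where no gcd is divided out.
toℚᵘ-ι : ∀ a → ℚ.toℚᵘ (ι a) ℚᵘ.≃ ℚᵘ.mkℚᵘ (+ a) 0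
toℚᵘ-ι a = ℚ.toℚᵘ-fromℚᵘ (ℚᵘ.mkℚᵘ (+ a) 0)

ι-+ : ∀ a b → ι (a ℕ.+ b) ≡ ι a ℚ.+ ι b
ι-+ a b = ℚ.toℚᵘ-injective (begin
  ℚ.toℚᵘ (ι (a ℕ.+ b))                      ≈⟨ toℚᵘ-ι (a ℕ.+ b) ⟩
  ℚᵘ.mkℚᵘ (+ (a ℕ.+ b)) 0                   ≈⟨ ℚᵘ.*≡* (cong (ℤ._* + 1)
    (sym (cong₂ ℤ._+_ (ℤ.*-identityʳ (+ a)) (ℤ.*-identityʳ (+ b))))) ⟩
  ℚᵘ.mkℚᵘ (+ a) 0 ℚᵘ.+ ℚᵘ.mkℚᵘ (+ b) 0      ≈⟨ ℚᵘ.+-cong (toℚᵘ-ι a) (toℚᵘ-ι b) ⟨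
  ℚ.toℚᵘ (ι a) ℚᵘ.+ ℚ.toℚᵘ (ι b)            ≈⟨ ℚ.toℚᵘ-homo-+ (ι a) (ι b) ⟨
  ℚ.toℚᵘ (ι a ℚ.+ ι b)                      ∎)
  where open ℚᵘ.≃-Reasoning

ι-* : ∀ a b → ι (a ℕ.* b) ≡ ι a * ι b
ι-* a b = ℚ.toℚᵘ-injective (begin
  ℚ.toℚᵘ (ι (a ℕ.* b))                      ≈⟨ toℚᵘ-ι (a ℕ.* b) ⟩
  ℚᵘ.mkℚᵘ (+ (a ℕ.* b)) 0                   ≈⟨ ℚᵘ.*≡* (cong (ℤ._* + 1) (ℤ.pos-* a b)) ⟩
  ℚᵘ.mkℚᵘ (+ a) 0 ℚᵘ.* ℚᵘ.mkℚᵘ (+ b) 0      ≈⟨ ℚᵘ.*-cong (toℚᵘ-ι a) (toℚᵘ-ι b) ⟨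
  ℚ.toℚᵘ (ι a) ℚᵘ.* ℚ.toℚᵘ (ι b)            ≈⟨ ℚ.toℚᵘ-homo-* (ι a) (ι b) ⟨
  ℚ.toℚᵘ (ι a * ι b)                        ∎)
  where open ℚᵘ.≃-Reasoning

ι-mono-< : ∀ {a b} → a ℕ.< b → ι a < ι b
ι-mono-< {a} {b} a<b = ℚ.toℚᵘ-cancel-<
  (ℚᵘ.<-respˡ-≃ (ℚᵘ.≃-sym (toℚᵘ-ι a)) (ℚᵘ.<-respʳ-≃ (ℚᵘ.≃-sym (toℚᵘ-ι b))
    (ℚᵘ.*<* (subst₂ ℤ._<_ (sym (ℤ.*-identityʳ (+ a))) (sym (ℤ.*-identityʳ (+ b))) (ℤ.+<+ a<b)))))

ι-mono-≤ : ∀ {a b} → a ℕ.≤ b → ι a ≤ ι b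
ι-mono-≤ {a} {b} a≤b with ℕ.m≤n⇒m<n∨m≡n a≤b
... | inj₁ a<b  = ℚ.<⇒≤ (ι-mono-< a<b)
... | inj₂ refl = ℚ.≤-refl

ι-cancel-< : ∀ {a b} → ι a < ι b → a ℕ.< b
ι-cancel-< {a} {b} ιa<ιb with b ℕ.≤? a
... | yes b≤a = contradiction (ℚ.<-≤-trans ιa<ιb (ι-mono-≤ b≤a)) (ℚ.<-irrefl refl)
... | no  b≰a = ℕ.≰⇒> b≰a

ι-cancel-≤ : ∀ {a b} → ι a ≤ ι b → a ℕ.≤ b
ι-cancel-≤ {a} {b} ιa≤ιb with a ℕ.≤? b
... | yes a≤b = a≤b
... | no  a≰b = contradiction (ℚ.<-≤-trans (ι-mono-< (ℕ.≰⇒> a≰b)) ιa≤ιb) (ℚ.<-irrefl refl)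

-- The bound in `ε`

module _ {ε : ℚ} (ε<1 : ε < 1ℚ) where

  ε*n<n : ∀ {n} → 0 ℕ.< n → ε * ι n < ι n
  ε*n<n {n} 0<n = subst (ε * ι n <_) (ℚ.*-identityˡ (ι n))
    (ℚ.*-monoˡ-<-pos (ι n) {{ℚ.positive (ι-mono-< 0<n)}} ε<1)

  -- Strictness ensures that `m = n − k` is at least 1.
  k≤ε*n⇒k<n : ∀ {n k} → 0 ℕ.< k → ι k ≤ ε * ι n → k ℕ.< n
  k≤ε*n⇒k<n {zero}  {k} 0<k k≤ = contradiction
    (ℚ.<-≤-trans (ι-mono-< 0<k) (subst (ι k ≤_) (ℚ.*-zeroʳ ε) k≤)) (ℚ.<-irrefl refl)
  k≤ε*n⇒k<n {suc n} 0<k k≤ = ι-cancel-< (ℚ.≤-<-trans k≤ (ε*n<n {suc n} (ℕ.s≤s ℕ.z≤n)))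

  -- From `k ≤ ε n` follows `(1 − ε) n ≤ n − k = m`; both ends are nonnegative, so this can be
  -- squared. Then `m² j < 4 (B + 1) ≤ 4 M`.
  quarter-bound : ∀ {j m B M} → ι (2 ℕ.+ j) ≤ ε * ι (2 ℕ.+ (j ℕ.+ m)) →
    m ℕ.* m ℕ.* j ℕ.< 4 ℕ.* suc B → B ℕ.< M →
    (+ 1 / 4) * ((1ℚ - ε) * (1ℚ - ε)) * (ι (2 ℕ.+ (j ℕ.+ m)) * ι (2 ℕ.+ (j ℕ.+ m))) * (ι (2 ℕ.+ j) - ι 2)
      < ι M
  quarter-bound {j} {m} {B} {M} k≤εn lt B<M = begin-strict
    (+ 1 / 4) * ((1ℚ - ε) * (1ℚ - ε)) * (N * N) * (ι (2 ℕ.+ j) - ι 2)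
      ≡⟨ cong ((+ 1 / 4) * ((1ℚ - ε) * (1ℚ - ε)) * (N * N) *_) k-2 ⟩
    (+ 1 / 4) * ((1ℚ - ε) * (1ℚ - ε)) * (N * N) * ι j
      ≡⟨ rearrange (+ 1 / 4) (1ℚ - ε) N (ι j) ⟩
    (+ 1 / 4) * (A * A * ι j)
      ≤⟨ ℚ.*-monoˡ-≤-nonNeg (+ 1 / 4)
           (ℚ.*-monoʳ-≤-nonNeg (ι j) {{ℚ.nonNegative (ι-mono-≤ {0} {j} ℕ.z≤n)}} A²≤m²) ⟩
    (+ 1 / 4) * (ι m * ι m * ι j)
      ≡⟨ cong ((+ 1 / 4) *_) (trans (ι-* (m ℕ.* m) j) (cong (_* ι j) (ι-* m m))) ⟨
    (+ 1 / 4) * ι (m ℕ.* m ℕ.* j)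
      <⟨ ℚ.*-monoʳ-<-pos (+ 1 / 4) (ι-mono-< (ℕ.<-≤-trans lt (ℕ.*-monoʳ-≤ 4 B<M))) ⟩
    (+ 1 / 4) * ι (4 ℕ.* M)
      ≡⟨ cong ((+ 1 / 4) *_) (ι-* 4 M) ⟩
    (+ 1 / 4) * (ι 4 * ι M)
      -- The closed product of a quarter and `ι 4` evaluates to `1ℚ`.
      ≡⟨ ℚ.*-assoc (+ 1 / 4) (ι 4) (ι M) ⟨
    1ℚ * ι M
      ≡⟨ ℚ.*-identityˡ (ι M) ⟩
    ι M ∎
    where
    open ℚ.≤-Reasoning
    open ℚ.+-*-Solver
    N = ι (2 ℕ.+ (j ℕ.+ m))
    A = (1ℚ - ε) * N

    rearrange : ∀ c d N j → c * (d * d) * (N * N) * j ≡ c * (d * N * (d * N) * j)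
    rearrange = solve 4 (λ c d N j →
      c :* (d :* d) :* (N :* N) :* j := c :* (d :* N :* (d :* N) :* j)) refl

    cancel : ∀ x y → (x ℚ.+ y) - x ≡ y
    cancel = solve 2 (λ x y → (x :+ y) :- x := y) refl

    expand : ∀ e x → (1ℚ - e) * x ≡ x - e * x
    expand = solve 2 (λ e x → (con 1ℚ :- e) :* x := x :- e :* x) refl

    k-2 : ι (2 ℕ.+ j) - ι 2 ≡ ι j
    k-2 = trans (cong (_- ι 2) (ι-+ 2 j)) (cancel (ι 2) (ι j))

    A≤m : A ≤ ι m
    A≤m = begin
      A                                      ≡⟨ expand ε N ⟩
      N - ε * N                              ≤⟨ ℚ.+-monoʳ-≤ N (ℚ.neg-antimono-≤ k≤εn) ⟩
      N - ι (2 ℕ.+ j)                        ≡⟨ cong (_- ι (2 ℕ.+ j)) (ι-+ (2 ℕ.+ j) m) ⟩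
      (ι (2 ℕ.+ j) ℚ.+ ι m) - ι (2 ℕ.+ j)    ≡⟨ cancel (ι (2 ℕ.+ j)) (ι m) ⟩
      ι m                                    ∎

    0≤A : 0ℚ ≤ A
    0≤A = begin
      0ℚ          ≡⟨ ℚ.+-inverseʳ (ε * N) ⟨
      ε * N - ε * N ≤⟨ ℚ.+-monoˡ-≤ (ℚ.- (ε * N)) (ℚ.<⇒≤ (ε*n<n {2 ℕ.+ (j ℕ.+ m)} (ℕ.s≤s ℕ.z≤n))) ⟩
      N - ε * N   ≡⟨ expand ε N ⟨
      A           ∎

    A²≤m² : A * A ≤ ι m * ι m
    A²≤m² = ℚ.≤-trans
      (ℚ.*-monoʳ-≤-nonNeg A {{ℚ.nonNegative 0≤A}} A≤m)
      (ℚ.*-monoˡ-≤-nonNeg (ι m) {{ℚ.nonNegative (ι-mono-≤ {0} {m} ℕ.z≤n)}} A≤m)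

theorem8 : (ε : ℚ) (n k : ℕ) →
    0ℚ < ε → ε < 1ℚ →
    (+ 2 / 1) ≤ ε * (+ n / 1) →
    (+ 2 / 1) ≤ (+ k / 1) → (+ k / 1) ≤ ε * (+ n / 1) →
    Σ (PV n k) λ G →
    Heterogeneous G × Irredundant G × Feasible G ×
    ((σ : Strategy G) →
    Σ _ λ y → Σ (IsStart G y) λ st →
    (+ 1 / 4) * ((1ℚ - ε) * (1ℚ - ε)) * ((+ n / 1) * (+ n / 1)) * ((+ k / 1) - (+ 2 / 1))
    < (+ moves (proj₁ (σ y st)) / 1))
theorem8 ε n k _ ε<1 _ 2≤k k≤εn
  with ℕ.m≤n⇒∃[o]m+o≡n (ι-cancel-≤ {2} {k} 2≤k)
... | j , refl
  with ℕ.m≤n⇒∃[o]m+o≡n (ℕ.<⇒≤ (k≤ε*n⇒k<n ε<1 {n} {2 ℕ.+ j} (ℕ.s≤s ℕ.z≤n) k≤εn))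
... | m , refl
  -- Here `k = 2 + j` and `n = k + m`; the search starts with no surplus carriers.
  with hard-exists j m 0
    (ℕ.+-cancelˡ-< (2 ℕ.+ j) 0 m
      (subst (ℕ._< (2 ℕ.+ j ℕ.+ m)) (sym (ℕ.+-identityʳ (2 ℕ.+ j)))
        (k≤ε*n⇒k<n ε<1 {n} {2 ℕ.+ j} (ℕ.s≤s ℕ.z≤n) k≤εn)))
... | B , lt , h
  with subst (λ i → Hard n (2 ℕ.+ i) B) (ℕ.+-identityʳ j) h
... | G , het , irr , feas , long = G , het , irr , feas , λ σ →
  let y , st , B<moves = long σ in y , st , quarter-bound ε<1 {j} {m} k≤εn lt B<moves
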